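{- Let $\mathcal{M}$ be an $L5$-model and let $\gamma\colon V\to M$ be an assignment in $\mathcal{M}$. Then there exist an $L5$-frame $(W,R)$, an $R$-maximal world $w_T\in W$ and an assignment $g\colon V\to\mathrm{Pow}(W)$ in $(W,R)$ such that for all formulas $\varphi$: $$(\mathcal{M},\gamma)\vDash\varphi \iff (w_T,g)\vDash\varphi.$$
   Context: Formulas are built from a countable set $V$ of propositional variables using $\wedge,\vee,\rightarrow,\bot$ and the unary modal operator $\square$; $\top$ abbreviates $\bot\rightarrow\bot$. An $L5$-model is a structure $\mathcal{M}=(M,\mathit{TRUE},f_\bot,f_\top,f_\rightarrow,f_\vee,f_\wedge,f_\square)$ such that $(M,f_\bot,f_\top,f_\rightarrow,f_\vee,f_\wedge)$ is a Heyting algebra (bottom $f_\bot$, top $f_\top$, relative pseudo-complement $f_\rightarrow$, lattice order $\le$). Moreover, $\mathit{TRUE}\subseteq M$ is an ultrafilter, and $f_\square\colon M\to M$ satisfies, for all $m,m',m''\in M$: (i) $f_\square(m)\le m$; (ii) $f_\square(f_\rightarrow(m,m'))\le f_\rightarrow(f_\square(f_\rightarrow(m',m'')),f_\square(f_\rightarrow(m,m'')))$; (iii) $f_\square(f_\vee(m,m'))\le f_\vee(f_\square(m),f_\square(m'))$; (iv) $f_\square(m)\in\mathit{TRUE}$ iff $m=f_\top$; (v) $f_\square(m)=f_\top$ if $m=f_\top$, and $f_\square(m)=f_\bot$ otherwise. An assignment $\gamma\colon V\to M$ extends to all formulas by: - $\gamma(\bot)=f_\bot$; - $\gamma(\square\varphi)=f_\square(\gamma(\varphi))$;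 - $\gamma(\varphi*\psi)=f_*(\gamma(\varphi),\gamma(\psi))$ for $*\in\{\vee,\wedge,\rightarrow\}$. Satisfaction is $(\mathcal{M},\gamma)\vDash\varphi$ iff $\gamma(\varphi)\in\mathit{TRUE}$. An $L5$-frame is a pair $(W,R)$ with the following properties: - $W$ is a non-empty set; - $R$ is a partial order on $W$; - there is an $R$-smallest element $w_B$; - every $R$-chain has an upper bound in $W$. An assignment in $(W,R)$ is a map $g\colon V\to\mathrm{Pow}(W)$ with $wRw'$ and $w\in g(x)$ implying $w'\in g(x)$. Kripke satisfaction is defined as follows: - $(w,g)\nvDash\bot$; - $(w,g)\vDash x$ iff $w\in g(x)$; - $\vee,\wedge$ are evaluated pointwise; - $(w,g)\vDash\varphi\rightarrow\psi$ iff for all $w'$ with $wRw'$, $(w',g)\vDash\varphi$ implies $(w',g)\vDash\psi$; - $(w,g)\vDash\square\varphi$ iff $(w_B,g)\vDash\varphi$. -}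

module Defs where

open import Data.Empty.Polymorphic using (⊥)
open import Data.Product using (∃; _×_)
open import Data.Sum using (_⊎_)
open import Function.Bundles using (_⇔_)
open import Level using (Level; _⊔_; suc)
open import Relation.Binary.Bundles using (Poset)
open import Relation.Binary.Definitions using (Minimum)
open import Relation.Binary.Lattice.Bundles using (HeytingAlgebra)
open import Relation.Nullary using (¬_)
open import Relation.Unary using (Pred; Satisfiable; _∈_; _∉_; _⊆_)

private
  variable
    c ℓ ℓ₁ ℓ₂ t : Level

infixr 7 _∧ᶠ_
infixr 6 _∨ᶠ_
infixr 5 _→ᶠ_

data Formula (V : Set) : Set where
  var  : V → Formula V
  ⊥ᶠ   : Formula V
  _∧ᶠ_ : Formula V → Formula V → Formula V
  _∨ᶠ_ : Formula V → Formula V → Formula V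
  _→ᶠ_ : Formula V → Formula V → Formula V
  □ᶠ_  : Formula V → Formula V

module _ (H : HeytingAlgebra c ℓ₁ ℓ₂) where
  open HeytingAlgebra H using (Carrier; _≤_; _∧_) renaming (⊥ to f⊥)

  record IsFilter (F : Pred Carrier t) : Set (c ⊔ ℓ₂ ⊔ t) where
    field
      nonempty : Satisfiable F
      upward   : ∀ {m m′} → m ≤ m′ → m ∈ F → m′ ∈ F
      ∧-closed : ∀ {m m′} → m ∈ F → m′ ∈ F → (m ∧ m′) ∈ F

  record IsProperFilter (F : Pred Carrier t) : Set (c ⊔ ℓ₂ ⊔ t) where
    field
      isFilter : IsFilter F
      proper   : f⊥ ∉ F

  record IsUltrafilter (U : Pred Carrier t) : Set (c ⊔ ℓ₂ ⊔ suc t) where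
    field
      isProperFilter : IsProperFilter U
      maximal        : (G : Pred Carrier t) → IsProperFilter G → U ⊆ G → G ⊆ U

record L5Model c ℓ₁ ℓ₂ t : Set (suc (c ⊔ ℓ₁ ⊔ ℓ₂ ⊔ t)) where
  field
    heytingAlgebra : HeytingAlgebra c ℓ₁ ℓ₂

  open HeytingAlgebra heytingAlgebra public
    using (Carrier; _≈_; _≤_; _∧_; _∨_; _⇨_)
    renaming (⊤ to f⊤; ⊥ to f⊥)

  field
    TRUE          : Pred Carrier t
    isUltrafilter : IsUltrafilter heytingAlgebra TRUE
    f□            : Carrier → Carrier
    -- Equality on the carrier is a setoid equality, so that f□ is a function
    -- on the algebra has to be required.
    f□-cong       : ∀ {m m′} → m ≈ m′ → f□ m ≈ f□ m′
    □-deflates    : ∀ m → f□ m ≤ m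
    □-trans       : ∀ m m′ m″ → f□ (m ⇨ m′) ≤ (f□ (m′ ⇨ m″) ⇨ f□ (m ⇨ m″))
    □-∨           : ∀ m m′ → f□ (m ∨ m′) ≤ (f□ m ∨ f□ m′)
    □-TRUE        : ∀ m → (f□ m ∈ TRUE) ⇔ (m ≈ f⊤)
    □-⊤           : ∀ m → m ≈ f⊤ → f□ m ≈ f⊤
    □-⊥           : ∀ m → ¬ (m ≈ f⊤) → f□ m ≈ f⊥

module _ {V : Set} (M : L5Model c ℓ₁ ℓ₂ t) (γ : V → L5Model.Carrier M) where
  open L5Model M

  value : Formula V → Carrier
  value (var x)  = γ x
  value ⊥ᶠ       = f⊥
  value (φ ∧ᶠ ψ) = value φ ∧ value ψ
  value (φ ∨ᶠ ψ) = value φ ∨ value ψ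
  value (φ →ᶠ ψ) = value φ ⇨ value ψ
  value (□ᶠ φ)   = f□ (value φ)

  ModelSat : Formula V → Set t
  ModelSat φ = value φ ∈ TRUE

module _ (P : Poset ℓ ℓ ℓ) where
  open Poset P using (Carrier) renaming (_≤_ to _R_)

  IsChain : Pred Carrier ℓ → Set ℓ
  IsChain C = ∀ {w w′} → w ∈ C → w′ ∈ C → (w R w′) ⊎ (w′ R w)

  IsUpperBound : Pred Carrier ℓ → Carrier → Set ℓ
  IsUpperBound C u = ∀ {w} → w ∈ C → w R u

record L5Frame ℓ : Set (suc ℓ) where
  field
    poset : Poset ℓ ℓ ℓ

  open Poset poset public
    using () renaming (Carrier to W; _≈_ to _≈ᵂ_; _≤_ to _R_)

  field
    -- The bottom world also witnesses that W is non-empty.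
    w-B         : W
    w-B-least   : Minimum _R_ w-B
    chain-bound : (C : Pred W ℓ) → IsChain poset C → ∃ (IsUpperBound poset C)

  IsMaximal : Pred W ℓ
  IsMaximal w = ∀ w′ → w R w′ → w ≈ᵂ w′

record FrameAssignment (V : Set) (F : L5Frame ℓ) : Set (suc ℓ) where
  open L5Frame F
  field
    ext        : V → Pred W ℓ
    hereditary : ∀ x {w w′} → w R w′ → w ∈ ext x → w′ ∈ ext x

module _ {V : Set} (F : L5Frame ℓ) (g : FrameAssignment V F) where
  open L5Frame F
  open FrameAssignment g

  KripkeSat : W → Formula V → Set ℓ
  KripkeSat w (var x)  = w ∈ ext x
  KripkeSat w ⊥ᶠ       = ⊥
  KripkeSat w (φ ∧ᶠ ψ) = KripkeSat w φ × KripkeSat w ψ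
  KripkeSat w (φ ∨ᶠ ψ) = KripkeSat w φ ⊎ KripkeSat w ψ
  KripkeSat w (φ →ᶠ ψ) = ∀ w′ → w R w′ → KripkeSat w′ φ → KripkeSat w′ ψ
  KripkeSat w (□ᶠ φ)   = KripkeSat w-B φ

{-# OPTIONS --safe #-}
-- The worlds are the prime filters of the algebra of formulas ordered by their
-- values in M, that is, of the subalgebra generated by γ.  Its least filter
-- {⊤} is prime because □ (m ∨ m′) ≤ □ m ∨ □ m′ where □ decides equality
-- with ⊤; it is the least world, and □ φ is forced iff φ has value ⊤.
-- A prime filter omitting φ → ψ extends, by enumerating the formulas, to one
-- containing φ but not ψ, whence a world forces exactly its members.
-- An ultrafilter contains m or m ⇨ ⊥ for every m, so TRUE restricts to a
-- maximal world.
-- Since worlds have to form a set in the lowest universe, order and membership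
-- are replaced by their truth values under excluded middle.
module Submission where

open import Defs
open import Axiom.ExcludedMiddle using (ExcludedMiddle)
open import Data.Bool using (Bool; T)
open import Data.Empty using (⊥-elim)
open import Data.List using (List; []; _∷_; _++_; foldr; head)
open import Data.List.Properties using (foldr-++)
open import Data.Maybe using (Maybe; just; nothing; maybe; fromMaybe)
open import Data.Nat using (ℕ; zero; suc; _⊔_)
  renaming (_≤′_ to _≤ℕ_; ≤′-refl to ≤ℕ-refl; ≤′-step to ≤ℕ-step)
open import Data.Nat.Binary using (ℕᵇ; zero; 2[1+_]; 1+[2_]; fromℕ; toℕ)
open import Data.Nat.Binary.Properties using (fromℕ-toℕ)
open import Data.Nat.Properties using (≤⇒≤′; m≤m⊔n; m≤n⊔m)
open import Data.Product using (Σ; ∃; Σ-syntax; _×_; _,_; proj₁; proj₂)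
open import Data.Sum using (_⊎_; inj₁; inj₂; [_,_]′)
open import Function using (_∘_; id)
open import Function.Bundles using (_↣_; _⇔_; mk⇔; module Injection)
open import Function.Definitions using (StrictlySurjective)
open import Level using (Level; 0ℓ)
open import Relation.Binary.Bundles using (Poset)
import Relation.Binary.Construct.On as On
open import Relation.Binary.Lattice.Bundles using (HeytingAlgebra)
import Relation.Binary.Lattice.Properties.HeytingAlgebra as HeytingProperties
open import Relation.Binary.PropositionalEquality
  using (_≡_; refl; trans; cong)
open import Relation.Nullary using (¬_; yes; no)
open import Relation.Nullary.Decidable using (True; isYes; toWitness; fromWitness)
open import Relation.Unary using (Pred; _∈_; _∉_; _⊆_; _≐_; ⋃)
open import Relation.Unary.Relation.Binary.Subset using (⊆-poset)

private
  variable
    a b c ℓ₁ ℓ₂ t : Level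

Classical = ∀ {ℓ} → ExcludedMiddle ℓ

-- Enumeration of the formulas over countably many variables.

module FormulaEnumeration (em : Classical) {V : Set} (code : V ↣ ℕ) where

  open Injection code using () renaming (to to codeOf; injective to code-injective)

  -- A partial left inverse of the coding: excluded middle settles whether a number is a code.
  decode : ℕ → Maybe V
  decode n with em {P = ∃ λ x → codeOf x ≡ n}
  ... | yes (x , _) = just x
  ... | no _        = nothing

  decode-code : ∀ x → decode (codeOf x) ≡ just x
  decode-code x with em {P = ∃ λ y → codeOf y ≡ codeOf x}
  ... | yes (y , eq) = cong just (code-injective eq)
  ... | no ∄         = ⊥-elim (∄ (x , refl))

  -- One step of a stack machine evaluating formulas in Polish notation from
  -- the right.
  step : ℕ → List (Formula V) → List (Formula V)
  step 0 s                                   = ⊥ᶠ ∷ s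
  step 1 (φ ∷ ψ ∷ s)                         = (φ ∧ᶠ ψ) ∷ s
  step 2 (φ ∷ ψ ∷ s)                         = (φ ∨ᶠ ψ) ∷ s
  step 3 (φ ∷ ψ ∷ s)                         = (φ →ᶠ ψ) ∷ s
  step 4 (φ ∷ s)                             = (□ᶠ φ) ∷ s
  step (suc (suc (suc (suc (suc n))))) s     = maybe (λ x → var x ∷ s) s (decode n)
  step _ s                                   = s

  polish : Formula V → List ℕ
  polish (var x)  = suc (suc (suc (suc (suc (codeOf x))))) ∷ []
  polish ⊥ᶠ       = 0 ∷ []
  polish (φ ∧ᶠ ψ) = 1 ∷ polish φ ++ polish ψ
  polish (φ ∨ᶠ ψ) = 2 ∷ polish φ ++ polish ψ
  polish (φ →ᶠ ψ) = 3 ∷ polish φ ++ polish ψ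
  polish (□ᶠ φ)   = 4 ∷ polish φ

  -- The stack `s` is arbitrary so that the induction passes through binary connectives: the right
  -- argument is evaluated first and then lies below the left one.
  step-polish  : ∀ φ s → foldr step s (polish φ) ≡ φ ∷ s
  step-polish₂ : ∀ φ ψ s → foldr step s (polish φ ++ polish ψ) ≡ φ ∷ ψ ∷ s

  step-polish (var x) s rewrite decode-code x = refl
  step-polish ⊥ᶠ       s = refl
  step-polish (φ ∧ᶠ ψ) s = cong (step 1) (step-polish₂ φ ψ s)
  step-polish (φ ∨ᶠ ψ) s = cong (step 2) (step-polish₂ φ ψ s)
  step-polish (φ →ᶠ ψ) s = cong (step 3) (step-polish₂ φ ψ s)
  step-polish (□ᶠ φ)   s = cong (step 4) (step-polish φ s)

  step-polish₂ φ ψ s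
    rewrite foldr-++ step s (polish φ) (polish ψ) | step-polish ψ s = step-polish φ (ψ ∷ s)

  incrementHead : List ℕ → List ℕ
  -- Digits `1+[2_]` that no terminator follows encode nothing.
  incrementHead []       = []
  incrementHead (n ∷ ns) = suc n ∷ ns

  -- Reads the digits 2[1+_] as terminators of unary numerals in 1+[2_].
  runs : ℕᵇ → List ℕ
  runs zero     = []
  runs 2[1+ b ] = 0 ∷ runs b
  runs 1+[2 b ] = incrementHead (runs b)

  cons : ℕ → ℕᵇ → ℕᵇ
  cons zero    b = 2[1+ b ]
  cons (suc n) b = 1+[2 cons n b ]

  runs-cons : ∀ n b → runs (cons n b) ≡ n ∷ runs b
  runs-cons zero    b = refl
  runs-cons (suc n) b = cong incrementHead (runs-cons n b)

  runs-foldr-cons : ∀ ns → runs (foldr cons zero ns) ≡ ns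
  runs-foldr-cons []       = refl
  runs-foldr-cons (n ∷ ns) = trans (runs-cons n _) (cong (n ∷_) (runs-foldr-cons ns))

  -- Surjectivity is the aim, so a number whose run leaves an empty stack may yield the default
  -- `⊥ᶠ`.
  formula : ℕ → Formula V
  formula n = fromMaybe ⊥ᶠ (head (foldr step [] (runs (fromℕ n))))

  formula-surjective : StrictlySurjective _≡_ formula
  formula-surjective φ = toℕ (foldr cons zero (polish φ)) , eq
    where
    eq : formula (toℕ (foldr cons zero (polish φ))) ≡ φ
    eq rewrite fromℕ-toℕ (foldr cons zero (polish φ))
             | runs-foldr-cons (polish φ)
             | step-polish φ [] = refl

-- Filters and ultrafilters of a Heyting algebra.

module Filters (H : HeytingAlgebra c ℓ₁ ℓ₂) where

  open HeytingAlgebra H renaming (refl to ≤-refl; trans to ≤-trans)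
  open HeytingProperties H hiding (¬_)

  Prime : Pred Carrier t → Set _
  Prime F = ∀ x y → (x ∨ y) ∈ F → x ∈ F ⊎ y ∈ F

  module _ {F : Pred Carrier t} (isFilter : IsFilter H F) where

    open IsFilter isFilter

    ⊤∈ : ⊤ ∈ F
    ⊤∈ = upward (maximum _) (proj₂ nonempty)

    ⇨-elim : ∀ {x y} → (x ⇨ y) ∈ F → x ∈ F → y ∈ F
    ⇨-elim p q = upward ⇨-eval (∧-closed p q)

    ∨-elim : ∀ {x y z} → (x ∨ y) ∈ F → (x ⇨ z) ∈ F → (y ⇨ z) ∈ F → z ∈ F
    ∨-elim p q r = ⇨-elim (upward (⇨-distribˡ-∨-∧-≥ _ _ _) (∧-closed q r)) p

  -- For a filter `F` this is the filter generated by `F` and `x`, since `f ∧ x ≤ y` iff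
  -- `f ≤ x ⇨ y`.
  adjoin : Carrier → Pred Carrier t → Pred Carrier t
  adjoin x F y = (x ⇨ y) ∈ F

  module _ {F : Pred Carrier t} (isFilter : IsFilter H F) where

    open IsFilter isFilter

    adjoin-isFilter : ∀ x → IsFilter H (adjoin x F)
    adjoin-isFilter x = record
      { nonempty = ⊤ , upward y≤x⇨y (⊤∈ isFilter)
      ; upward   = upward ∘ ⇨ʳ-covariant
      ; ∧-closed = λ p q → upward (⇨-distribˡ-∧-≥ _ _ _) (∧-closed p q)
      }

    ⊆-adjoin : ∀ {x} → F ⊆ adjoin x F
    ⊆-adjoin = upward y≤x⇨y

    ∈-adjoin : ∀ {x y} → x ≤ y → y ∈ adjoin x F
    ∈-adjoin x≤y = upward (transpose-⇨ (≤-trans (x∧y≤y _ _) x≤y)) (⊤∈ isFilter)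

    adjoin-antitone : ∀ {x y} → y ≤ x → adjoin x F ⊆ adjoin y F
    adjoin-antitone y≤x p = upward (⇨ˡ-contravariant y≤x) p

  ⋃-isFilter : {I : Set a} {F : I → Pred Carrier t} → I → (∀ i → IsFilter H (F i)) →
               (∀ i j → ∃ λ k → F i ⊆ F k × F j ⊆ F k) → IsFilter H (⋃ I F)
  ⋃-isFilter i isFilter directed = record
    { nonempty = ⊤ , i , ⊤∈ (isFilter i)
    ; upward   = λ { x≤y (i , p) → i , IsFilter.upward (isFilter i) x≤y p }
    ; ∧-closed = λ { (i , p) (j , q) →
        let k , Fi⊆Fk , Fj⊆Fk = directed i j
        in k , IsFilter.∧-closed (isFilter k) (Fi⊆Fk p) (Fj⊆Fk q) }
    }

  isFilter-resp : {F : Pred Carrier a} {G : Pred Carrier b} → F ≐ G → IsFilter H F → IsFilter H G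
  isFilter-resp (F⊆G , G⊆F) isFilter = record
    { nonempty = ⊤ , F⊆G (⊤∈ isFilter)
    ; upward   = λ x≤y p → F⊆G (upward x≤y (G⊆F p))
    ; ∧-closed = λ p q → F⊆G (∧-closed (G⊆F p) (G⊆F q))
    }
    where open IsFilter isFilter

  ⊤-isFilter : IsFilter H (⊤ ≤_)
  ⊤-isFilter = record
    { nonempty = ⊤ , ≤-refl
    ; upward   = λ x≤y p → ≤-trans p x≤y
    ; ∧-closed = ∧-greatest
    }

  module _ (em : Classical) {U : Pred Carrier t} (isUltrafilter : IsUltrafilter H U) where

    open IsUltrafilter isUltrafilter
    open IsProperFilter isProperFilter
    open IsFilter isFilter

    -- That `adjoin x U` contains `⊥` means literally that `U` contains `x ⇨ ⊥`. Otherwise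
    -- `adjoin x U` is proper, and maximality puts `x` into `U`.
    ultrafilter-complete : ∀ x → x ∈ U ⊎ (x ⇨ ⊥) ∈ U
    ultrafilter-complete x with em {P = (x ⇨ ⊥) ∈ U}
    ... | yes ¬x∈U = inj₂ ¬x∈U
    ... | no  ¬x∉U = inj₁ (maximal (adjoin x U)
      (record { isFilter = adjoin-isFilter isFilter x ; proper = ¬x∉U })
      (⊆-adjoin isFilter) (∈-adjoin isFilter ≤-refl))

    ultrafilter-prime : Prime U
    ultrafilter-prime x y x∨y∈U with ultrafilter-complete x | ultrafilter-complete y
    ... | inj₁ x∈U  | _         = inj₁ x∈U
    ... | inj₂ _    | inj₁ y∈U  = inj₂ y∈U
    ... | inj₂ ¬x∈U | inj₂ ¬y∈U = ⊥-elim (proper (∨-elim isFilter x∨y∈U ¬x∈U ¬y∈U))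

  -- Extension to a prime filter containing `x` and omitting `y`.

  module PrimeExtension
    (em : Classical) (enum : ℕ → Carrier) (enum-surjective : StrictlySurjective _≡_ enum)
    {F : Pred Carrier t} (isFilter : IsFilter H F)
    {x y : Carrier} (x⇨y∉F : (x ⇨ y) ∉ F) where

    open IsFilter isFilter

    -- Stage `n` of the extension is `adjoin (generator n) F`, so a single element records all
    -- choices made so far. The next element is added unless this would put `y` into the filter.
    generator : ℕ → Carrier
    generator zero = x
    generator (suc n) with em {P = (generator n ∧ enum n ⇨ y) ∈ F}
    ... | yes _ = generator n
    ... | no  _ = generator n ∧ enum n

    generator-suc : ∀ n → generator (suc n) ≤ generator n
    generator-suc n with em {P = (generator n ∧ enum n ⇨ y) ∈ F}
    ... | yes _ = ≤-refl
    ... | no  _ = x∧y≤x _ _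

    generator-antitone : ∀ {m n} → m ≤ℕ n → generator n ≤ generator m
    generator-antitone ≤ℕ-refl        = ≤-refl
    generator-antitone (≤ℕ-step m≤n) = ≤-trans (generator-suc _) (generator-antitone m≤n)

    extension : Pred Carrier t
    extension = ⋃ ℕ (λ n → adjoin (generator n) F)

    extension-isFilter : IsFilter H extension
    extension-isFilter = ⋃-isFilter 0 (λ n → adjoin-isFilter isFilter (generator n)) λ m n →
      m ⊔ n , adjoin-antitone isFilter (generator-antitone (≤⇒≤′ (m≤m⊔n m n)))
            , adjoin-antitone isFilter (generator-antitone (≤⇒≤′ (m≤n⊔m m n)))

    ⊆-extension : F ⊆ extension
    ⊆-extension p = 0 , ⊆-adjoin isFilter p

    x∈extension : x ∈ extension
    x∈extension = 0 , ∈-adjoin isFilter ≤-refl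

    y∉extension : y ∉ extension
    y∉extension (n , p) = avoids n p
      where
      avoids : ∀ n → y ∉ adjoin (generator n) F
      avoids zero p = x⇨y∉F p
      avoids (suc n) p with em {P = (generator n ∧ enum n ⇨ y) ∈ F}
      ... | yes _ = avoids n p
      ... | no  q = q p

    -- An accepted `z` lies above the next generator. A rejected one has `generator n ∧ z ⇨ y` in
    -- `F`, and currying places `z ⇨ y` in stage `n`. Primeness follows as for ultrafilters, with
    -- `y` in the role of `⊥`.
    extension-relatively-complete : ∀ z → z ∈ extension ⊎ (z ⇨ y) ∈ extension
    extension-relatively-complete z with enum-surjective z
    ... | n , refl with em {P = (generator n ∧ enum n ⇨ y) ∈ F} in eq
    ...   | yes p = inj₂ (n , upward (reflexive ⇨-curry) p)
    ...   | no  _ = inj₁ (suc n , ∈-adjoin isFilter below)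
      where
      below : generator (suc n) ≤ enum n
      below rewrite eq = x∧y≤y _ _

    extension-prime : Prime extension
    extension-prime z z′ z∨z′∈
      with extension-relatively-complete z | extension-relatively-complete z′
    ... | inj₁ z∈   | _         = inj₁ z∈
    ... | inj₂ _    | inj₁ z′∈  = inj₂ z′∈
    ... | inj₂ z⇨y∈ | inj₂ z′⇨y∈ =
      ⊥-elim (y∉extension (∨-elim extension-isFilter z∨z′∈ z⇨y∈ z′⇨y∈))

-- The frame of prime filters under inclusion.

module PrimeFilterFrame (em : Classical) (H : HeytingAlgebra 0ℓ 0ℓ 0ℓ) where

  open HeytingAlgebra H hiding (refl; trans)
  open Filters H

  record PrimeFilter : Set where
    field
      member         : Carrier → Bool
      isProperFilter : IsProperFilter H (T ∘ member)
      prime          : Prime (T ∘ member)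

    open IsProperFilter isProperFilter public
    open IsFilter isFilter public

    Member : Pred Carrier 0ℓ
    Member = T ∘ member

  open PrimeFilter

  module _ {F : Pred Carrier t} (F-isFilter : IsFilter H F) (⊥∉F : ⊥ ∉ F) (F-prime : Prime F) where

    primeFilter : PrimeFilter
    primeFilter = record
      { member         = λ x → isYes (em {P = x ∈ F})
      ; isProperFilter = record
        { isFilter = isFilter-resp (fromWitness , toWitness) F-isFilter
        ; proper   = ⊥∉F ∘ toWitness
        }
      ; prime = λ x y →
          [ inj₁ ∘ fromWitness , inj₂ ∘ fromWitness ]′ ∘ F-prime x y ∘ toWitness
      }

  inclusion : Poset 0ℓ 0ℓ 0ℓ
  inclusion = On.poset (⊆-poset Carrier 0ℓ) Member

  module _ (⊤≰⊥ : ¬ (⊤ ≤ ⊥)) (⊤-prime : Prime (⊤ ≤_)) where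

    least : PrimeFilter
    least = primeFilter ⊤-isFilter ⊤≰⊥ ⊤-prime

    least-minimum : ∀ P → Member least ⊆ Member P
    least-minimum P p = upward P (toWitness p) (⊤∈ (isFilter P))

    module _ (C : Pred PrimeFilter 0ℓ) (isChain : IsChain inclusion C) where

      chain-directed : (P Q : Σ PrimeFilter C) → Σ[ S ∈ Σ PrimeFilter C ]
        (Member (proj₁ P) ⊆ Member (proj₁ S) × Member (proj₁ Q) ⊆ Member (proj₁ S))
      chain-directed (P , P∈C) (Q , Q∈C) with isChain P∈C Q∈C
      ... | inj₁ P⊆Q = (Q , Q∈C) , P⊆Q , id
      ... | inj₂ Q⊆P = (P , P∈C) , id , Q⊆P

      chain-bound : ∃ (IsUpperBound inclusion C)
      chain-bound with em {P = ∃ C}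
      -- The empty union is not a filter, so the empty chain is bounded by the least world.
      ... | no  empty = least , λ P∈C → ⊥-elim (empty (_ , P∈C))
      ... | yes P     = bound , λ P∈C p → fromWitness ((_ , P∈C) , p)
        where
        bound : PrimeFilter
        -- Closure under meets uses that two members of a chain lie in a common one; properness and
        -- primeness are inherited from the single member containing the given element.
        bound = primeFilter {F = ⋃ (Σ PrimeFilter C) (Member ∘ proj₁)}
          (⋃-isFilter P (isFilter ∘ proj₁) chain-directed)
          (λ { ((Q , _) , p) → proper Q p })
          (λ { x y (Q , p) → [ inj₁ ∘ (Q ,_) , inj₂ ∘ (Q ,_) ]′ (prime (proj₁ Q) x y p) })

    frame : L5Frame 0ℓ
    frame = record
      { poset       = inclusion
      ; w-B         = least
      ; w-B-least   = λ P → least-minimum P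
      ; chain-bound = chain-bound
      }

    -- An `x` in a larger `Q` but not in `P` would have its negation in `P`, hence in `Q`, making
    -- `Q` improper.
    complete⇒maximal : ∀ P → (∀ x → x ∈ Member P ⊎ (x ⇨ ⊥) ∈ Member P) → L5Frame.IsMaximal frame P
    complete⇒maximal P complete Q P⊆Q = P⊆Q , Q⊆P
      where
      Q⊆P : Member Q ⊆ Member P
      Q⊆P {x} x∈Q with complete x
      ... | inj₁ x∈P  = x∈P
      ... | inj₂ ¬x∈P = ⊥-elim (proper Q (⇨-elim (isFilter Q) (P⊆Q ¬x∈P) x∈Q))

-- The frame, assignment and maximal world obtained from the model.

module CanonicalFrame
  (em : Classical) {V : Set} (code : V ↣ ℕ)
  (M : L5Model c ℓ₁ ℓ₂ t) (γ : V → L5Model.Carrier M) where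

  open L5Model M
  module H = HeytingAlgebra heytingAlgebra
  open FormulaEnumeration em code using (formula; formula-surjective)

  ⟦_⟧ : Formula V → Carrier
  ⟦_⟧ = value M γ

  -- Formulas themselves form the carrier because they can be enumerated and lie in the lowest
  -- universe, whatever the size and level of the carrier of `M`.
  Lindenbaum : HeytingAlgebra 0ℓ 0ℓ 0ℓ
  Lindenbaum = record
    { Carrier = Formula V
    ; _≈_     = λ φ ψ → True (em {P = ⟦ φ ⟧ ≈ ⟦ ψ ⟧})
    ; _≤_     = λ φ ψ → True (em {P = ⟦ φ ⟧ ≤ ⟦ ψ ⟧})
    ; _∨_     = _∨ᶠ_
    ; _∧_     = _∧ᶠ_
    ; _⇨_     = _→ᶠ_
    ; ⊤       = ⊥ᶠ →ᶠ ⊥ᶠ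
    ; ⊥       = ⊥ᶠ
    ; isHeytingAlgebra = record
      { isBoundedLattice = record
        { isLattice = record
          { isPartialOrder = record
            { isPreorder = record
              { isEquivalence = record
                { refl  = fromWitness H.Eq.refl
                ; sym   = λ p → fromWitness (H.Eq.sym (toWitness p))
                ; trans = λ p q → fromWitness (H.Eq.trans (toWitness p) (toWitness q))
                }
              ; reflexive = λ p → fromWitness (H.reflexive (toWitness p))
              ; trans     = λ p q → fromWitness (H.trans (toWitness p) (toWitness q))
              }
            ; antisym = λ p q → fromWitness (H.antisym (toWitness p) (toWitness q))
            }
          ; supremum = λ φ ψ →
              fromWitness (H.x≤x∨y _ _) , fromWitness (H.y≤x∨y _ _) ,
              λ χ p q → fromWitness (H.∨-least (toWitness p) (toWitness q))
          ; infimum = λ φ ψ →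
              fromWitness (H.x∧y≤x _ _) , fromWitness (H.x∧y≤y _ _) ,
              λ χ p q → fromWitness (H.∧-greatest (toWitness p) (toWitness q))
          }
        ; maximum = λ φ → fromWitness (H.transpose-⇨ (H.x∧y≤y _ _))
        ; minimum = λ φ → fromWitness (H.minimum _)
        }
      ; exponential = λ φ ψ χ →
          (λ p → fromWitness (H.transpose-⇨ (toWitness p))) ,
          (λ p → fromWitness (H.transpose-∧ (toWitness p)))
      }
    }

  module L = HeytingAlgebra Lindenbaum
  open Filters Lindenbaum
  open PrimeFilterFrame em Lindenbaum
  open PrimeFilter using (Member; isFilter; proper; prime; upward; ∧-closed)

  open IsUltrafilter isUltrafilter using (isProperFilter)
  open IsProperFilter isProperFilter using () renaming (isFilter to TRUE-isFilter; proper to ⊥∉TRUE)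

  module Model = Filters heytingAlgebra

  f⊤≰f⊥ : ¬ (f⊤ ≤ f⊥)
  f⊤≰f⊥ p = ⊥∉TRUE (IsFilter.upward TRUE-isFilter p (Model.⊤∈ TRUE-isFilter))

  f⊤≤⟦⊤⟧ : f⊤ ≤ ⟦ L.⊤ ⟧
  f⊤≤⟦⊤⟧ = H.transpose-⇨ (H.x∧y≤y _ _)

  ⊤≤⇒≈f⊤ : ∀ {φ} → L.⊤ L.≤ φ → ⟦ φ ⟧ ≈ f⊤
  ⊤≤⇒≈f⊤ p = H.antisym (H.maximum _) (H.trans f⊤≤⟦⊤⟧ (toWitness p))

  ≈f⊤⇒⊤≤ : ∀ {φ} → ⟦ φ ⟧ ≈ f⊤ → L.⊤ L.≤ φ
  ≈f⊤⇒⊤≤ p = fromWitness (H.trans (H.maximum _) (H.reflexive (H.Eq.sym p)))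

  ⊤≰⊥ : ¬ (L.⊤ L.≤ L.⊥)
  ⊤≰⊥ p = f⊤≰f⊥ (H.reflexive (H.Eq.sym (⊤≤⇒≈f⊤ {⊥ᶠ} p)))

  f⊤-prime : ∀ m m′ → (m ∨ m′) ≈ f⊤ → m ≈ f⊤ ⊎ m′ ≈ f⊤
  f⊤-prime m m′ p with em {P = m ≈ f⊤} | em {P = m′ ≈ f⊤}
  ... | yes q | _     = inj₁ q
  ... | no _  | yes q = inj₂ q
  -- Both boxes are now `f⊥`, while the box of the join is `f⊤`, which collapses the algebra.
  ... | no q  | no r  = ⊥-elim (f⊤≰f⊥ (begin
    f⊤           ≈⟨ □-⊤ _ p ⟨
    f□ (m ∨ m′)  ≤⟨ □-∨ m m′ ⟩
    f□ m ∨ f□ m′ ≤⟨ H.∨-least (H.reflexive (□-⊥ m q)) (H.reflexive (□-⊥ m′ r)) ⟩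
    f⊥           ∎))
    where open import Relation.Binary.Reasoning.PartialOrder H.poset

  ⊤-prime : Prime (L.⊤ L.≤_)
  ⊤-prime φ ψ p with f⊤-prime _ _ (⊤≤⇒≈f⊤ {φ ∨ᶠ ψ} p)
  ... | inj₁ q = inj₁ (≈f⊤⇒⊤≤ {φ} q)
  ... | inj₂ q = inj₂ (≈f⊤⇒⊤≤ {ψ} q)

  F : L5Frame 0ℓ
  F = frame ⊤≰⊥ ⊤-prime

  open L5Frame F using (w-B; w-B-least)

  g : FrameAssignment V F
  g = record
    { ext        = λ x P → var x ∈ Member P
    ; hereditary = λ x P⊆Q → P⊆Q
    }

  ModelSat-isFilter : IsFilter Lindenbaum (ModelSat M γ)
  ModelSat-isFilter = record
    { nonempty = L.⊤ , TRUE.upward f⊤≤⟦⊤⟧ (Model.⊤∈ TRUE-isFilter)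
    ; upward   = λ p → TRUE.upward (toWitness p)
    ; ∧-closed = TRUE.∧-closed
    }
    where module TRUE = IsFilter TRUE-isFilter

  w-T : PrimeFilter
  w-T = primeFilter ModelSat-isFilter ⊥∉TRUE
    (λ φ ψ → Model.ultrafilter-prime em isUltrafilter ⟦ φ ⟧ ⟦ ψ ⟧)

  w-T-maximal : L5Frame.IsMaximal F w-T
  w-T-maximal = complete⇒maximal ⊤≰⊥ ⊤-prime w-T λ φ →
    [ inj₁ ∘ fromWitness , inj₂ ∘ fromWitness ]′
      (Model.ultrafilter-complete em isUltrafilter ⟦ φ ⟧)

  -- Truth lemma: forcing at a world is membership in it.

  truth⇒ : ∀ P φ → KripkeSat F g P φ → φ ∈ Member P
  -- The two directions are mutually recursive because each case of implication needs the opposite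
  -- direction for the antecedent.
  truth⇐ : ∀ P φ → φ ∈ Member P → KripkeSat F g P φ

  truth⇒ P (var x)  s              = s
  truth⇒ P ⊥ᶠ       ()
  truth⇒ P (φ ∧ᶠ ψ) (s , s′)       = ∧-closed P (truth⇒ P φ s) (truth⇒ P ψ s′)
  truth⇒ P (φ ∨ᶠ ψ) (inj₁ s)       = upward P (L.x≤x∨y φ ψ) (truth⇒ P φ s)
  truth⇒ P (φ ∨ᶠ ψ) (inj₂ s)       = upward P (L.y≤x∨y φ ψ) (truth⇒ P ψ s)
  truth⇒ P (φ →ᶠ ψ) s with em {P = (φ →ᶠ ψ) ∈ Member P}
  ... | yes p = p
  ... | no  q = ⊥-elim (y∉extension (toWitness (truth⇒ Q ψ
          (s Q (fromWitness ∘ ⊆-extension) (truth⇐ Q φ (fromWitness x∈extension))))))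
    where
    open PrimeExtension em formula formula-surjective (isFilter P) q
    Q : PrimeFilter
    Q = primeFilter extension-isFilter
      -- Omitting `ψ` already makes the extension proper, as `⊥ᶠ` lies below `ψ`.
      (λ p → y∉extension (IsFilter.upward extension-isFilter (L.minimum ψ) p)) extension-prime
  -- Membership of `φ` in the least filter means value `f⊤`; then `□ᶠ φ` has value `f⊤` too and lies
  -- in every world.
  truth⇒ P (□ᶠ φ)   s = w-B-least P (fromWitness (≈f⊤⇒⊤≤ {□ᶠ φ}
    (□-⊤ _ (⊤≤⇒≈f⊤ {φ} (toWitness (truth⇒ w-B φ s))))))

  truth⇐ P (var x)  p = p
  truth⇐ P ⊥ᶠ       p = ⊥-elim (proper P p)
  truth⇐ P (φ ∧ᶠ ψ) p = truth⇐ P φ (upward P (L.x∧y≤x φ ψ) p)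
                      , truth⇐ P ψ (upward P (L.x∧y≤y φ ψ) p)
  truth⇐ P (φ ∨ᶠ ψ) p with prime P φ ψ p
  ... | inj₁ q = inj₁ (truth⇐ P φ q)
  ... | inj₂ q = inj₂ (truth⇐ P ψ q)
  truth⇐ P (φ →ᶠ ψ) p Q P⊆Q s = truth⇐ Q ψ (⇨-elim (isFilter Q) (P⊆Q p) (truth⇒ Q φ s))
  truth⇐ P (□ᶠ φ)   p with em {P = ⟦ φ ⟧ ≈ f⊤}
  ... | yes q = truth⇐ w-B φ (fromWitness (≈f⊤⇒⊤≤ {φ} q))
  -- Here `□ᶠ φ` has value `f⊥`, so no proper filter contains it.
  ... | no  q = ⊥-elim (proper P (upward P (fromWitness (H.reflexive (□-⊥ _ q))) p))

theorem5p2 : (∀ {ℓ} → ExcludedMiddle ℓ) →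
    {c ℓ₁ ℓ₂ t : Level} {V : Set} → V ↣ ℕ →
    (M : L5Model c ℓ₁ ℓ₂ t) (γ : V → L5Model.Carrier M) →
    Σ[ F ∈ L5Frame 0ℓ ] Σ[ w-T ∈ L5Frame.W F ] Σ[ g ∈ FrameAssignment V F ]
    (L5Frame.IsMaximal F w-T ×
    (∀ (φ : Formula V) → ModelSat M γ φ ⇔ KripkeSat F g w-T φ))
theorem5p2 em code M γ = F , w-T , g , w-T-maximal , λ φ →
    mk⇔ (truth⇐ w-T φ ∘ fromWitness) (toWitness ∘ truth⇒ w-T φ)
  where open CanonicalFrame em code M γ
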